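{- Let $R=\{(2,2),(2,3),(3,2),(3,3)\}$. Then $(123,R)\sim_d(132,R)$.
   Context: $S_n$ denotes the set of permutations of $[n]=\{1,\dots,n\}$, written $\pi=\pi_1\cdots\pi_n$. A mesh pattern of length $k$ is a pair $(\tau,R)$ with $\tau\in S_k$ and $R\subseteq\{0,1,\dots,k\}^2$ (the shaded boxes; box $(a,b)$ is the unit square $[a,a+1]\times[b,b+1]$ in the diagram of $\tau$). An occurrence of $(\tau,R)$ in $\pi\in S_n$ is a choice of indices $i_1<\dots<i_k$ such that $\pi_{i_1}\cdots\pi_{i_k}$ is order-isomorphic to $\tau$ and, with $i_0=0$, $i_{k+1}=n+1$, $v_1<\dots<v_k$ the values $\pi_{i_1},\dots,\pi_{i_k}$ sorted increasingly, $v_0=0$, $v_{k+1}=n+1$, for every $(a,b)\in R$ there is no index $m$ with $i_a<m<i_{a+1}$ and $v_b<\pi_m<v_{b+1}$. Mesh patterns $p,q$ are equidistributed, $p\sim_d q$, if for all $n,\ell\ge0$ the number of $\pi\in S_n$ with exactly $\ell$ occurrences of $p$ equals the number with exactly $\ell$ occurrences of $q$. -}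

module Defs where

open import Data.Nat using (ℕ; zero; suc; _<_; _<?_)
open import Data.Nat.Properties using (≤-decTotalOrder)
import Data.Nat as ℕ
open import Data.Fin as Fin using (Fin; toℕ)
open import Data.Fin.Properties using (all?)
open import Data.Vec using (Vec; []; _∷_; lookup; toList)
open import Data.List as List using (List; []; _∷_; length; filter; concatMap; map; allFin)
open import Data.List.Membership.Propositional using (_∈_)
open import Data.List.Sort.InsertionSort ≤-decTotalOrder using (sort)
open import Data.Product using (_×_; _,_)
open import Relation.Binary.PropositionalEquality using (_≡_; _≢_)
open import Relation.Nullary using (Dec; yes; no; ¬_; ¬?)
open import Data.List.Relation.Unary.Any using (here; there)
open import Relation.Binary.PropositionalEquality using (refl)
open import Relation.Nullary.Decidable using (_×-dec_; _→-dec_)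

allWords : (n k : ℕ) → List (Vec (Fin n) k)
allWords n zero    = [] ∷ []
allWords n (suc k) = concatMap (λ x → map (x ∷_) (allWords n k)) (allFin n)

-- Permutations of [n]: words π = π₁⋯πₙ of length n over [n]
-- (value j ∈ [n] encoded as the Fin n element j-1, position i likewise)
-- whose entries are pairwise distinct.

IsPerm : ∀ {n} → Vec (Fin n) n → Set
IsPerm π = ∀ i j → lookup π i ≡ lookup π j → i ≡ j

isPerm? : ∀ {n} (π : Vec (Fin n) n) → Dec (IsPerm π)
isPerm? π = all? λ i → all? λ j → (lookup π i Fin.≟ lookup π j) →-dec (i Fin.≟ j)

S : (n : ℕ) → List (Vec (Fin n) n)
S n = filter isPerm? (allWords n n)

-- Mesh patterns (τ , R): τ ∈ S_k in one-line notation with values 1..k,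
-- R ⊆ {0..k}² the shaded boxes.

record MeshPattern (k : ℕ) : Set where
  constructor mesh
  field
    τ : Vec ℕ k
    R : List (ℕ × ℕ)

-- 1-based position and value of entry at (0-based) position m of π
pos : ∀ {n} → Fin n → ℕ
pos m = suc (toℕ m)

val : ∀ {n} → Vec (Fin n) n → Fin n → ℕ
val π m = suc (toℕ (lookup π m))

-- i_a for a ∈ {0,…,k+1}: i_0 = 0, i_{k+1} = n+1, i_a = position of a-th chosen index
idxBound : ∀ {n k} → Vec (Fin n) k → ℕ → ℕ
idxBound {n} {k} is zero = 0
idxBound {n} {k} is (suc a) with a ℕ.<? k
... | yes a<k = pos (lookup is (Fin.fromℕ< a<k))
... | no  _   = suc n

nth : List ℕ → ℕ → ℕ → ℕ
nth []       d _       = d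
nth (x ∷ xs) d zero    = x
nth (x ∷ xs) d (suc b) = nth xs d b

-- v_b for b ∈ {0,…,k+1}: v_0 = 0, v_{k+1} = n+1, v_1 < ⋯ < v_k the chosen
-- values sorted increasingly
valBound : ∀ {n k} → Vec (Fin n) n → Vec (Fin n) k → ℕ → ℕ
valBound {n} π is zero    = 0
valBound {n} π is (suc b) =
  nth (sort (map (val π) (toList is))) (suc n) b

Increasing : ∀ {n k} → Vec (Fin n) k → Set
Increasing {k = k} is = ∀ (a b : Fin k) → toℕ a < toℕ b → toℕ (lookup is a) < toℕ (lookup is b)

OrderIso : ∀ {n k} → Vec (Fin n) n → Vec ℕ k → Vec (Fin n) k → Set
OrderIso {k = k} π τ is = ∀ (a b : Fin k) →
  ((val π (lookup is a) < val π (lookup is b)) → (lookup τ a < lookup τ b)) ×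
  ((lookup τ a < lookup τ b) → (val π (lookup is a) < val π (lookup is b)))

BoxEmpty : ∀ {n k} → Vec (Fin n) n → Vec (Fin n) k → ℕ × ℕ → Set
BoxEmpty {n} π is (a , b) = ∀ (m : Fin n) → ¬
  ((idxBound is a < pos m) × (pos m < idxBound is (suc a)) ×
   (valBound π is b < val π m) × (val π m < valBound π is (suc b)))

Occurrence : ∀ {n k} → MeshPattern k → Vec (Fin n) n → Vec (Fin n) k → Set
Occurrence (mesh τ R) π is =
  Increasing is × OrderIso π τ is × (∀ {box} → box ∈ R → BoxEmpty π is box)

private
  allR? : ∀ {P : ℕ × ℕ → Set} → (∀ x → Dec (P x)) → (R : List (ℕ × ℕ)) → Dec (∀ {x} → x ∈ R → P x)
  allR? P? [] = yes λ ()
  allR? {P} P? (x ∷ R) with P? x | allR? P? R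
  ... | yes px | yes pR = yes λ { (here refl) → px ; (there m) → pR m }
  ... | no ¬px | _      = no λ f → ¬px (f (here refl))
  ... | yes _  | no ¬pR = no λ f → ¬pR λ m → f (there m)

occurrence? : ∀ {n k} (p : MeshPattern k) (π : Vec (Fin n) n) (is : Vec (Fin n) k) → Dec (Occurrence p π is)
occurrence? (mesh τ R) π is =
  (all? λ a → all? λ b → (toℕ a <? toℕ b) →-dec (toℕ (lookup is a) <? toℕ (lookup is b)))
  ×-dec
  (all? λ a → all? λ b →
     ((val π (lookup is a) <? val π (lookup is b)) →-dec (lookup τ a <? lookup τ b)) ×-dec
     ((lookup τ a <? lookup τ b) →-dec (val π (lookup is a) <? val π (lookup is b))))
  ×-dec
  allR? (λ { (a , b) → all? λ m → ¬?
     ((_ <? _) ×-dec (_ <? _) ×-dec (_ <? _) ×-dec (_ <? _)) }) R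

occ : ∀ {n k} → MeshPattern k → Vec (Fin n) n → ℕ
occ {n} {k} p π = length (filter (occurrence? p π) (allWords n k))

countWith : ∀ {k} → MeshPattern k → (n ℓ : ℕ) → ℕ
countWith p n ℓ = length (filter (λ π → occ p π ℕ.≟ ℓ) (S n))

Equidistributed : ∀ {k k'} → MeshPattern k → MeshPattern k' → Set
Equidistributed p q = ∀ (n ℓ : ℕ) → countWith p n ℓ ≡ countWith q n ℓ

{-# OPTIONS --safe #-}

-- Build a permutation from right to left by repeatedly prepending a value and
-- relabelling the old values around it.  In an occurrence of (123, R) the
-- letters 2 and 3 are an entry b together with the only entry north-east of b;
-- in an occurrence of (132, R) they are two consecutive right-to-left maxima.
-- In both cases the letter 1 is an arbitrary entry south-west of a corner, and
-- the height of this corner is the value of the letter 2.  Prepending v to a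
-- permutation adds one occurrence for every corner of height at least v.  It
-- creates a new corner only when v is the second largest value (for 123),
-- respectively the largest value (for 132); the new corner has second largest
-- height both times.  Inserting either of the two largest values adds no
-- occurrence and moves no old corner, so exchanging these two values at every
-- insertion matches both statistics.
module Submission where

open import Defs
open import Data.Nat using (ℕ; zero; suc; pred; z≤n; s≤s; s≤s⁻¹; _≤?_) renaming (_+_ to _+ₙ_; _≤_ to _≤ₙ_; _<_ to _<ₙ_; _≟_ to _≟ₙ_)
import Data.Nat.Properties as ℕₚ
open import Data.Bool using (if_then_else_; true; false)
open import Data.Fin using (Fin; zero; suc; toℕ; fromℕ; fromℕ<; punchIn; punchOut; _≤_; _<_; _≟_)
open import Data.Fin.Properties using (all?; toℕ-injective; toℕ-fromℕ; toℕ-fromℕ<; toℕ<n; toℕ≤pred[n]; suc-injective; punchIn-injective; punchInᵢ≢i; punchIn-mono-≤; punchIn-cancel-≤; punchIn-punchOut; punchOut-injective; _<?_; <-cmp) renaming (_≤?_ to _≤F?_)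
open import Data.Vec using (Vec; []; _∷_; lookup; tabulate; map; toList)
open import Data.Vec.Properties using (lookup-map; ∷-injective; ∷-injectiveˡ; ∷-injectiveʳ; tabulate-∘; tabulate-cong; tabulate∘lookup; lookup∘tabulate)
open import Data.List as List using (List; []; _∷_; length; filter; concatMap; allFin; cartesianProductWith)
open import Data.List.Sort.InsertionSort ℕₚ.≤-decTotalOrder using (sort)
open import Data.List.Properties using (length-++; filter-++; map-cong; map-∘)
open import Data.List.Membership.Propositional using (_∈_)
open import Data.List.Membership.Propositional.Properties using (∈-allFin; ∈-map⁺; ∈-map⁻; ∈-filter⁺; ∈-filter⁻; ∈-cartesianProductWith⁺)
open import Data.List.Relation.Binary.BagAndSetEquality using (∼bag⇒↭)
open import Data.List.Membership.Propositional.Properties.WithK using (unique∧set⇒bag)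
open import Data.List.Relation.Binary.Permutation.Propositional using (_↭_; ↭-trans; ↭-sym; ↭-reflexive)
open import Data.List.Relation.Binary.Permutation.Propositional.Properties using (filter-↭; ↭-length; map⁺)
open import Data.List.Relation.Unary.Any using (here; there)
open import Data.List.Relation.Unary.Unique.Propositional using (Unique)
import Data.List.Relation.Unary.Unique.Propositional.Properties as Unique
open import Data.List.Relation.Unary.AllPairs using ([]; _∷_)
open import Data.List.Relation.Unary.All using ([])
open import Data.Product using (_×_; _,_; proj₁; proj₂; ∃)
open import Data.Sum using (_⊎_; inj₁; inj₂)
open import Level using (0ℓ)
open import Function using (_∘_; _⇔_; mk⇔; id)
open import Function.Bundles using (Equivalence)
open import Relation.Nullary using (Dec; yes; no; ¬_; does; contradiction)
open import Relation.Nullary.Decidable using (_×-dec_; _→-dec_; does-⇔; dec-true; dec-false; toWitness)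
open import Relation.Unary using (Pred; Decidable)
open import Relation.Binary.PropositionalEquality using (_≡_; _≢_; refl; sym; trans; cong; cong₂; subst; module ≡-Reasoning)
open import Relation.Binary.Definitions using (tri<; tri≈; tri>)
open import Algebra.Properties.Monoid.Sum ℕₚ.+-0-monoid using (sum; sum-syntax; sum-cong-≗; sum-replicate-zero)
open Equivalence using (to; from)

-- Counting

⟦_⟧ : ∀ {p} {P : Set p} → Dec P → ℕ
⟦ P? ⟧ = if does P? then 1 else 0

⟦⟧-cong : ∀ {P Q : Set} → P ⇔ Q → (P? : Dec P) (Q? : Dec Q) → ⟦ P? ⟧ ≡ ⟦ Q? ⟧
⟦⟧-cong P⇔Q P? Q? = cong (if_then 1 else 0) (does-⇔ P⇔Q P? Q?)

⟦⟧-false : ∀ {P : Set} (P? : Dec P) → ¬ P → ⟦ P? ⟧ ≡ 0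
⟦⟧-false P? ¬P = cong (if_then 1 else 0) (dec-false P? ¬P)

sum-zero : ∀ {n} {f : Fin n → ℕ} → (∀ i → f i ≡ 0) → sum f ≡ 0
sum-zero {n} f≗0 = trans (sum-cong-≗ f≗0) (sum-replicate-zero n)

-- Serves to count new corners: their other end is forced to be the largest old entry, and there the
-- condition reduces to a bound on the height.
sum-single : ∀ {n} {X : Fin n → Set} {T : Set} (X? : ∀ k → Dec (X k)) (T? : Dec T) (k₀ : Fin n) →
             (∀ k → X k → k ≡ k₀) → (X k₀ ⇔ T) → ∑[ k < n ] ⟦ X? k ⟧ ≡ ⟦ T? ⟧
sum-single X? T? zero only X⇔T =
  trans (cong₂ _+ₙ_ (⟦⟧-cong X⇔T (X? zero) T?)
                    (sum-zero λ k → ⟦⟧-false (X? (suc k)) λ x → contradiction (only (suc k) x) λ ()))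
        (ℕₚ.+-identityʳ _)
sum-single X? T? (suc k₀) only X⇔T =
  cong₂ _+ₙ_ (⟦⟧-false (X? zero) λ x → contradiction (only zero x) λ ())
             (sum-single (X? ∘ suc) T? k₀ (λ k → suc-injective ∘ only (suc k)) X⇔T)

zero-+ : ∀ {a b} → a ≡ 0 → a +ₙ b ≡ b
zero-+ refl = refl

count₂ : ∀ {n} {X : Fin n → Fin n → Set} → (∀ j k → Dec (X j k)) → ℕ
count₂ {n} X? = ∑[ j < n ] ∑[ k < n ] ⟦ X? j k ⟧

count₂-cong : ∀ {n} {X Y : Fin n → Fin n → Set} (X? : ∀ j k → Dec (X j k)) (Y? : ∀ j k → Dec (Y j k)) →
              (∀ j k → X j k ⇔ Y j k) → count₂ X? ≡ count₂ Y?
count₂-cong X? Y? X⇔Y = sum-cong-≗ λ j → sum-cong-≗ λ k → ⟦⟧-cong (X⇔Y j k) (X? j k) (Y? j k)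

-- After a front insertion this separates the pairs that start at the new entry from the pairs of
-- old entries; `j < k` kills the column of position `zero`.
count₂-strict : ∀ {n} {X : Fin (suc n) → Fin (suc n) → Set} (X? : ∀ j k → Dec (X j k)) →
                (∀ j k → X j k → j < k) →
                count₂ X? ≡ ∑[ k < n ] ⟦ X? zero (suc k) ⟧ +ₙ count₂ (λ j k → X? (suc j) (suc k))
count₂-strict X? X⇒< =
  cong₂ _+ₙ_ (zero-+ (⟦⟧-false (X? zero zero) λ x → contradiction (X⇒< _ _ x) λ ()))
             (sum-cong-≗ λ j → zero-+ (⟦⟧-false (X? (suc j) zero) λ x → contradiction (X⇒< _ _ x) λ ()))

-- Insertion and corners

punchIn-<⇔ : ∀ {n} (v : Fin (suc n)) (x y : Fin n) → punchIn v x < punchIn v y ⇔ x < y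
punchIn-<⇔ v x y = mk⇔
  (λ p → ℕₚ.≰⇒> λ q → ℕₚ.<⇒≱ p (punchIn-mono-≤ v y x q))
  (λ p → ℕₚ.≰⇒> λ q → ℕₚ.<⇒≱ p (punchIn-cancel-≤ v y x q))

-- The adjoint of punchIn v: it transports thresholds on values across an insertion of v.
lower : ℕ → ℕ → ℕ
lower zero    t       = pred t
lower (suc v) zero    = zero
lower (suc v) (suc t) = suc (lower v t)

≤-punchIn⇔ : ∀ {n} (v : Fin (suc n)) (y : Fin n) t → t ≤ₙ toℕ (punchIn v y) ⇔ lower (toℕ v) t ≤ₙ toℕ y
≤-punchIn⇔ zero    y       zero    = mk⇔ (λ _ → z≤n) (λ _ → z≤n)
≤-punchIn⇔ zero    y       (suc t) = mk⇔ s≤s⁻¹ s≤s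
≤-punchIn⇔ (suc v) zero    zero    = mk⇔ id id
≤-punchIn⇔ (suc v) zero    (suc t) = mk⇔ (λ ()) (λ ())
≤-punchIn⇔ (suc v) (suc y) zero    = mk⇔ (λ _ → z≤n) (λ _ → z≤n)
≤-punchIn⇔ (suc v) (suc y) (suc t) = mk⇔ (s≤s ∘ to (≤-punchIn⇔ v y t) ∘ s≤s⁻¹)
                                         (s≤s ∘ from (≤-punchIn⇔ v y t) ∘ s≤s⁻¹)

lower-≤ : ∀ {v t} → t ≤ₙ v → lower v t ≡ t
lower-≤ {zero}  z≤n       = refl
lower-≤ {suc v} z≤n       = refl
lower-≤ {suc v} (s≤s t≤v) = cong suc (lower-≤ t≤v)

lower-> : ∀ {v t} → v ≤ₙ t → lower v (suc t) ≡ t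
lower-> {zero}  _         = refl
lower-> {suc v} (s≤s v≤t) = cong suc (lower-> v≤t)

-- The adjunction at the threshold `suc v`, which `lower` sends to `v`: the old value equal to `v`
-- is itself pushed above the new entry, so the bound becomes weak.
<-punchIn⇔ : ∀ {n} (v : Fin (suc n)) (y : Fin n) → v < punchIn v y ⇔ toℕ v ≤ₙ toℕ y
<-punchIn⇔ v y = subst (λ l → v < punchIn v y ⇔ l ≤ₙ toℕ y) (lower-> (ℕₚ.≤-refl {toℕ v})) (≤-punchIn⇔ v y (suc (toℕ v)))

insert : ∀ {n} → Fin (suc n) → Vec (Fin n) n → Vec (Fin (suc n)) (suc n)
insert v π = v ∷ map (punchIn v) π

lookup-insert : ∀ {n} v (π : Vec (Fin n) n) i → lookup (insert v π) (suc i) ≡ punchIn v (lookup π i)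
lookup-insert v π i = lookup-map i (punchIn v) π

insert-<⇔ : ∀ {n} v (π : Vec (Fin n) n) i j →
            lookup (insert v π) (suc i) < lookup (insert v π) (suc j) ⇔ lookup π i < lookup π j
insert-<⇔ v π i j rewrite lookup-insert v π i | lookup-insert v π j = punchIn-<⇔ v _ _

insert-≤⇔ : ∀ {n} v (π : Vec (Fin n) n) i j →
            lookup (insert v π) (suc i) ≤ lookup (insert v π) (suc j) ⇔ lookup π i ≤ lookup π j
insert-≤⇔ v π i j rewrite lookup-insert v π i | lookup-insert v π j =
  mk⇔ (punchIn-cancel-≤ v _ _) (punchIn-mono-≤ v _ _)

head-<⇔ : ∀ {n} v (π : Vec (Fin n) n) i → v < lookup (insert v π) (suc i) ⇔ v ≤ lookup π i
head-<⇔ v π i rewrite lookup-insert v π i = <-punchIn⇔ v _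

height⇔ : ∀ {n} v (π : Vec (Fin n) n) i t →
          t ≤ₙ toℕ (lookup (insert v π) (suc i)) ⇔ lower (toℕ v) t ≤ₙ toℕ (lookup π i)
height⇔ v π i t rewrite lookup-insert v π i = ≤-punchIn⇔ v _ t

-- Corner π j k says that j and k are the positions of the last two letters of an
-- occurrence; the first letter then ranges over the entries south-west of the
-- corner (j , lookup π (base j k)).
record CornerKind : Set₁ where
  field
    base          : ∀ {n} → Fin n → Fin n → Fin n
    Corner        : ∀ {n} → Vec (Fin n) n → Fin n → Fin n → Set
    corner?       : ∀ {n} (π : Vec (Fin n) n) j k → Dec (Corner π j k)
    base-suc      : ∀ {n} (j k : Fin n) → base (suc j) (suc k) ≡ suc (base j k)
    corner⇒<      : ∀ {n} {π : Vec (Fin n) n} {j k} → Corner π j k → j < k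
    -- Both kinds involve only entries from position `j` on, and only their relative order, which a
    -- front insertion preserves.
    corner-insert : ∀ {n} v (π : Vec (Fin n) n) j k → Corner (insert v π) (suc j) (suc k) ⇔ Corner π j k
    -- The base lies below the other entry of the pair, so its value is never the largest. This is
    -- what makes the insertion of either of the two largest values harmless.
    corner-low    : ∀ {n} {π : Vec (Fin n) n} {j k} → Corner π j k → suc (toℕ (lookup π (base j k))) <ₙ n

  -- The induction needs the whole distribution of heights: prepending a value counts the corners at
  -- or above it, and it also shifts the thresholds.
  HighCorner : ∀ {n} → Vec (Fin n) n → ℕ → Fin n → Fin n → Set
  HighCorner π t j k = t ≤ₙ toℕ (lookup π (base j k)) × Corner π j k

  highCorner? : ∀ {n} (π : Vec (Fin n) n) t j k → Dec (HighCorner π t j k)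
  highCorner? π t j k = (t ≤? toℕ (lookup π (base j k))) ×-dec corner? π j k

  #corners : ∀ {n} → Vec (Fin n) n → ℕ → ℕ
  #corners π t = count₂ (highCorner? π t)

  Triple : ∀ {n} → Vec (Fin n) n → Fin n → Fin n → Fin n → Set
  Triple π i j k = i < j × lookup π i < lookup π (base j k) × Corner π j k

  triple? : ∀ {n} (π : Vec (Fin n) n) i j k → Dec (Triple π i j k)
  triple? π i j k = (i <? j) ×-dec (lookup π i <? lookup π (base j k)) ×-dec corner? π j k

  #triples : ∀ {n} → Vec (Fin n) n → ℕ
  #triples {n} π = ∑[ i < n ] count₂ (triple? π i)

  #newCorners : ∀ {n} → Fin (suc n) → Vec (Fin n) n → ℕ → ℕ
  #newCorners {n} v π t = ∑[ k < n ] ⟦ highCorner? (insert v π) t zero (suc k) ⟧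

  -- Old corners stay corners; only their heights are relabelled, and the adjunction moves this
  -- relabelling onto the threshold.
  #corners-insert : ∀ {n} v (π : Vec (Fin n) n) t →
                    #corners (insert v π) t ≡ #newCorners v π t +ₙ #corners π (lower (toℕ v) t)
  #corners-insert v π t = trans
    (count₂-strict (highCorner? (insert v π) t) (λ _ _ → corner⇒< ∘ proj₂))
    (cong (#newCorners v π t +ₙ_)
      (count₂-cong (λ j k → highCorner? (insert v π) t (suc j) (suc k)) (highCorner? π (lower (toℕ v) t)) equiv))
    where
    equiv : ∀ j k → HighCorner (insert v π) t (suc j) (suc k) ⇔ HighCorner π (lower (toℕ v) t) j k
    equiv j k rewrite base-suc j k = mk⇔
      (λ (h , c) → to (height⇔ v π _ t) h , to (corner-insert v π j k) c)
      (λ (h , c) → from (height⇔ v π _ t) h , from (corner-insert v π j k) c)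

  -- The new leftmost entry can only play the letter 1. It lies below a relabelled base exactly when
  -- the old height is at least `v`.
  #triples-insert : ∀ {n} v (π : Vec (Fin n) n) →
                    #triples (insert v π) ≡ #corners π (toℕ v) +ₙ #triples π
  #triples-insert {n} v π = cong₂ _+ₙ_
    (trans (strip zero) (count₂-cong (tripleTail? zero) (highCorner? π (toℕ v)) equiv₀))
    (sum-cong-≗ λ i → trans (strip (suc i)) (count₂-cong (tripleTail? (suc i)) (triple? π i) (equiv i)))
    where
    tripleTail? : ∀ i j k → Dec (Triple (insert v π) i (suc j) (suc k))
    tripleTail? i j k = triple? (insert v π) i (suc j) (suc k)

    strip : ∀ i → count₂ (triple? (insert v π) i) ≡ count₂ (tripleTail? i)
    strip i = trans
      (count₂-strict (triple? (insert v π) i) (λ _ _ → corner⇒< ∘ proj₂ ∘ proj₂))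
      -- The row `j = zero` vanishes because no position `i` precedes `zero`.
      (zero-+ (sum-zero λ k → ⟦⟧-false (triple? (insert v π) i zero (suc k)) λ ()))

    equiv₀ : ∀ j k → Triple (insert v π) zero (suc j) (suc k) ⇔ HighCorner π (toℕ v) j k
    equiv₀ j k rewrite base-suc j k = mk⇔
      (λ (_ , h , c) → to (head-<⇔ v π _) h , to (corner-insert v π j k) c)
      (λ (h , c) → s≤s z≤n , from (head-<⇔ v π _) h , from (corner-insert v π j k) c)

    equiv : ∀ i j k → Triple (insert v π) (suc i) (suc j) (suc k) ⇔ Triple π i j k
    equiv i j k rewrite base-suc j k = mk⇔
      (λ (i<j , h , c) → s≤s⁻¹ i<j , to (insert-<⇔ v π i _) h , to (corner-insert v π j k) c)
      (λ (i<j , h , c) → s≤s i<j , from (insert-<⇔ v π i _) h , from (corner-insert v π j k) c)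

  #corners-above : ∀ {m t} (π : Vec (Fin (suc m)) (suc m)) → m ≤ₙ t → #corners π t ≡ 0
  #corners-above {t = t} π m≤t = sum-zero λ j → sum-zero λ k → ⟦⟧-false (highCorner? π t j k)
    λ (h , c) → ℕₚ.<⇒≱ (s≤s⁻¹ (corner-low c)) (ℕₚ.≤-trans m≤t h)

  -- Thresholds up to `v` are fixed by `lower`. A threshold beyond `v` drops by one but stays at
  -- least `m`, above every height, so both counts are zero.
  #corners-lower : ∀ {m v} (π : Vec (Fin (suc m)) (suc m)) → m ≤ₙ v → ∀ t →
                   #corners π (lower v t) ≡ #corners π t
  #corners-lower {v = v} π m≤v t with t ≤? v
  ... | yes t≤v = cong (#corners π) (lower-≤ t≤v)
  #corners-lower {v = v} π m≤v zero    | no 0≰v = contradiction z≤n 0≰v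
  #corners-lower {v = v} π m≤v (suc t) | no t≰v = begin
    #corners π (lower v (suc t)) ≡⟨ cong (#corners π) (lower-> v≤t) ⟩
    #corners π t                 ≡⟨ #corners-above π (ℕₚ.≤-trans m≤v v≤t) ⟩
    0                            ≡⟨ #corners-above π (ℕₚ.≤-trans m≤v (ℕₚ.m≤n⇒m≤1+n v≤t)) ⟨
    #corners π (suc t)           ∎
    where
    open ≡-Reasoning
    v≤t = s≤s⁻¹ (ℕₚ.≰⇒> t≰v)

-- The corners of the two patterns

kind123 : CornerKind
kind123 = record
  { base          = λ j k → j
  ; Corner        = Corner
  ; corner?       = λ π j k → (j <? k) ×-dec (_ <? _) ×-dec all? λ m → (j <? m) →-dec ((_ <? _) →-dec (m ≟ k))
  ; base-suc      = λ _ _ → refl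
  ; corner⇒<      = proj₁
  ; corner-insert = λ v π j k → mk⇔
      (λ (j<k , p , u) → s≤s⁻¹ j<k , to (insert-<⇔ v π j k) p ,
         λ m j<m q → suc-injective (u (suc m) (s≤s j<m) (from (insert-<⇔ v π j m) q)))
      (λ (j<k , p , u) → s≤s j<k , from (insert-<⇔ v π j k) p ,
         λ { (suc m) j<m q → cong suc (u m (s≤s⁻¹ j<m) (to (insert-<⇔ v π j m) q)) })
  ; corner-low    = λ {π = π} {k = k} (_ , p , _) → ℕₚ.≤-trans (s≤s p) (toℕ<n (lookup π k))
  }
  where
  Corner : ∀ {n} → Vec (Fin n) n → Fin n → Fin n → Set
  Corner π j k = j < k × lookup π j < lookup π k × (∀ m → j < m → lookup π j < lookup π m → m ≡ k)

kind132 : CornerKind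
kind132 = record
  { base          = λ j k → k
  ; Corner        = Corner
  ; corner?       = λ π j k → (j <? k) ×-dec (_ <? _) ×-dec all? λ m → (j <? m) →-dec (_ ≤F? _)
  ; base-suc      = λ _ _ → refl
  ; corner⇒<      = proj₁
  ; corner-insert = λ v π j k → mk⇔
      (λ (j<k , p , u) → s≤s⁻¹ j<k , to (insert-<⇔ v π k j) p ,
         λ m j<m → to (insert-≤⇔ v π m k) (u (suc m) (s≤s j<m)))
      (λ (j<k , p , u) → s≤s j<k , from (insert-<⇔ v π k j) p ,
         λ { (suc m) j<m → from (insert-≤⇔ v π m k) (u m (s≤s⁻¹ j<m)) })
  ; corner-low    = λ {π = π} {j = j} (_ , p , _) → ℕₚ.≤-trans (s≤s p) (toℕ<n (lookup π j))
  }
  where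
  Corner : ∀ {n} → Vec (Fin n) n → Fin n → Fin n → Set
  Corner π j k = j < k × lookup π k < lookup π j × (∀ m → j < m → lookup π m ≤ lookup π k)

-- Insertion codes

-- These are Lehmer codes: a digit is the number of later entries smaller than the entry it inserts,
-- and the head digit belongs to the leftmost entry.
data Code : ℕ → Set where
  []  : Code zero
  _∷_ : ∀ {n} → Fin (suc n) → Code n → Code (suc n)

decode : ∀ {n} → Code n → Vec (Fin n) n
decode []      = []
decode (v ∷ c) = insert v (decode c)

swapTop : ∀ {n} → Fin (suc n) → Fin (suc n)
swapTop {zero}        v          = v
swapTop {suc zero}    zero       = suc zero
swapTop {suc zero}    (suc zero) = zero
swapTop {suc (suc n)} zero       = zero
swapTop {suc (suc n)} (suc v)    = suc (swapTop v)

swapTop-involutive : ∀ {n} (v : Fin (suc n)) → swapTop (swapTop v) ≡ v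
swapTop-involutive {zero}        v          = refl
swapTop-involutive {suc zero}    zero       = refl
swapTop-involutive {suc zero}    (suc zero) = refl
swapTop-involutive {suc (suc n)} zero       = refl
swapTop-involutive {suc (suc n)} (suc v)    = cong suc (swapTop-involutive v)

-- Among the values `0` to `suc m` the two largest are `m` and `suc m`. The size starts at two,
-- since a single value has no partner to be exchanged with.
data SwapTopView {m} (v : Fin (suc (suc m))) : Set where
  below  : toℕ v <ₙ m → swapTop v ≡ v → SwapTopView v
  second : toℕ v ≡ m → toℕ (swapTop v) ≡ suc m → SwapTopView v
  top    : toℕ v ≡ suc m → toℕ (swapTop v) ≡ m → SwapTopView v

swapTopView : ∀ {m} (v : Fin (suc (suc m))) → SwapTopView v
swapTopView {zero}  zero       = second refl refl
swapTopView {zero}  (suc zero) = top refl refl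
swapTopView {suc m} zero       = below (s≤s z≤n) refl
swapTopView {suc m} (suc v) with swapTopView v
... | below p q  = below (s≤s p) (cong suc q)
... | second p q = second (cong suc p) (cong suc q)
... | top p q    = top (cong suc p) (cong suc q)

exchange : ∀ {n} → Code n → Code n
exchange []      = []
exchange (v ∷ c) = swapTop v ∷ exchange c

exchange-involutive : ∀ {n} (c : Code n) → exchange (exchange c) ≡ c
exchange-involutive []      = refl
exchange-involutive (v ∷ c) = cong₂ _∷_ (swapTop-involutive v) (exchange-involutive c)

insert-isPerm : ∀ {n} v {π : Vec (Fin n) n} → IsPerm π → IsPerm (insert v π)
insert-isPerm v {π} inj zero    zero    _ = refl
insert-isPerm v {π} inj zero    (suc j) e =
  contradiction (trans (sym (lookup-insert v π j)) (sym e)) (punchInᵢ≢i v _)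
insert-isPerm v {π} inj (suc i) zero    e =
  contradiction (trans (sym (lookup-insert v π i)) e) (punchInᵢ≢i v _)
insert-isPerm v {π} inj (suc i) (suc j) e =
  cong suc (inj i j (punchIn-injective v _ _ (trans (sym (lookup-insert v π i)) (trans e (lookup-insert v π j)))))

decode-isPerm : ∀ {n} (c : Code n) → IsPerm (decode c)
decode-isPerm []      ()
decode-isPerm (v ∷ c) = insert-isPerm v (decode-isPerm c)

-- A value other than the head is the `punchIn` image of a value of the tail. The witness serves to
-- locate the largest entry and the entry of a given value.
decode-onto : ∀ {n} (c : Code n) x → ∃ λ i → lookup (decode c) i ≡ x
decode-onto (v ∷ c) x with v ≟ x
... | yes v≡x = zero , v≡x
... | no  v≢x = let i , e = decode-onto c (punchOut v≢x) in
  suc i , trans (lookup-insert v (decode c) i) (trans (cong (punchIn v) e) (punchIn-punchOut v≢x))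

map-punchIn-injective : ∀ {n m} v (xs ys : Vec (Fin n) m) → map (punchIn v) xs ≡ map (punchIn v) ys → xs ≡ ys
map-punchIn-injective v []       []       _ = refl
map-punchIn-injective v (x ∷ xs) (y ∷ ys) e =
  cong₂ _∷_ (punchIn-injective v x y (∷-injectiveˡ e)) (map-punchIn-injective v xs ys (∷-injectiveʳ e))

decode-injective : ∀ {n} {c d : Code n} → decode c ≡ decode d → c ≡ d
decode-injective {c = []}    {[]}    _ = refl
decode-injective {c = v ∷ c} {w ∷ d} e with refl ← ∷-injectiveˡ e =
  cong (v ∷_) (decode-injective (map-punchIn-injective v _ _ (∷-injectiveʳ e)))

-- The entries after the head avoid its value, so `punchOut` standardises them to a smaller
-- permutation `σ`, which is decoded recursively.
isPerm⇒decode : ∀ {n} (π : Vec (Fin n) n) → IsPerm π → ∃ λ c → decode c ≡ π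
isPerm⇒decode []      _   = [] , refl
isPerm⇒decode (v ∷ w) inj =
  let c , e = isPerm⇒decode σ σ-isPerm in
  v ∷ c , cong (v ∷_) (begin
    map (punchIn v) (decode c) ≡⟨ cong (map (punchIn v)) e ⟩
    map (punchIn v) σ          ≡⟨ tabulate-∘ (punchIn v) _ ⟨
    tabulate (λ i → punchIn v (punchOut (v≢ i))) ≡⟨ tabulate-cong (λ i → punchIn-punchOut (v≢ i)) ⟩
    tabulate (lookup w)        ≡⟨ tabulate∘lookup w ⟩
    w                          ∎)
  where
  open ≡-Reasoning
  v≢ : ∀ i → v ≢ lookup w i
  v≢ i e = contradiction (inj zero (suc i) e) λ ()
  σ = tabulate λ i → punchOut (v≢ i)
  σ-isPerm : IsPerm σ
  σ-isPerm i j e = suc-injective (inj (suc i) (suc j) (punchOut-injective (v≢ i) (v≢ j)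
    (trans (sym (lookup∘tabulate _ i)) (trans e (lookup∘tabulate _ j)))))

-- New corners and the exchange of the two largest values

module K123 = CornerKind kind123
module K132 = CornerKind kind132

module _ {m} (c : Code (suc m)) (v : Fin (suc (suc m))) (t : ℕ) where
  private
    π  = decode c
    -- The position of the largest entry: the values of `π` run from `0` to `m`.
    k₀ = proj₁ (decode-onto c (fromℕ m))

    π[k₀]≡m : toℕ (lookup π k₀) ≡ m
    π[k₀]≡m = trans (cong toℕ (proj₂ (decode-onto c (fromℕ m)))) (toℕ-fromℕ m)

    π≤π[k₀] : ∀ k → lookup π k ≤ lookup π k₀
    π≤π[k₀] k = ℕₚ.≤-trans (toℕ≤pred[n] (lookup π k)) (ℕₚ.≤-reflexive (sym π[k₀]≡m))

    top-unique : ∀ {k} → m ≤ₙ toℕ (lookup π k) → k ≡ k₀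
    top-unique {k} m≤ = decode-isPerm c _ _ (toℕ-injective
      (ℕₚ.≤-antisym (π≤π[k₀] k) (ℕₚ.≤-trans (ℕₚ.≤-reflexive π[k₀]≡m) m≤)))

  -- Only the old maximum `m` is pushed above the new entry, so it is the unique entry north-east of
  -- it, and the new corner has height `m`.
  #newCorners123-second : toℕ v ≡ m → K123.#newCorners v π t ≡ ⟦ t ≤? m ⟧
  #newCorners123-second v≡m = sum-single (K123.highCorner? (insert v π) t zero ∘ suc) (t ≤? m) k₀
    (λ k (_ , _ , p , _) → top-unique (subst (_≤ₙ _) v≡m (to (head-<⇔ v π k) p)))
    (mk⇔ (subst (t ≤ₙ_) v≡m ∘ proj₁)
         (λ t≤m → subst (t ≤ₙ_) (sym v≡m) t≤m , s≤s z≤n ,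
           from (head-<⇔ v π k₀) (ℕₚ.≤-reflexive (trans v≡m (sym π[k₀]≡m))) ,
           λ { (suc k) _ p → cong suc (top-unique (subst (_≤ₙ _) v≡m (to (head-<⇔ v π k) p))) }))

  -- For `v` below `m` at least two entries, the old values `v` and `m`, end up above the new one;
  -- for `v` above `m` there is none.
  #newCorners123-other : toℕ v ≢ m → K123.#newCorners v π t ≡ 0
  #newCorners123-other v≢m = sum-zero λ k → ⟦⟧-false (K123.highCorner? (insert v π) t zero (suc k))
    λ (_ , _ , p , u) →
      -- By `p` some old value is at least `v`, so `v` is itself an old value, at position `k₁`.
      -- Uniqueness identifies `k₁` and `k₀` with `k`, forcing `v` to be `m`.
      let v≤m = ℕₚ.≤-trans (to (head-<⇔ v π k) p) (toℕ≤pred[n] (lookup π k))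
          v<1+m = s≤s v≤m
          k₁ , e = decode-onto c (fromℕ< v<1+m)
          π[k₁]≡v = trans (cong toℕ e) (toℕ-fromℕ< v<1+m)
          k₁≡k = u (suc k₁) (s≤s z≤n) (from (head-<⇔ v π k₁) (ℕₚ.≤-reflexive (sym π[k₁]≡v)))
          k₀≡k = u (suc k₀) (s≤s z≤n) (from (head-<⇔ v π k₀) (ℕₚ.≤-trans v≤m (ℕₚ.≤-reflexive (sym π[k₀]≡m))))
          k₁≡k₀ = suc-injective (trans k₁≡k (sym k₀≡k))
      in v≢m (trans (sym π[k₁]≡v) (trans (cong (toℕ ∘ lookup π) k₁≡k₀) π[k₀]≡m))

  -- A new overall maximum is followed, as next right-to-left maximum, by the old maximum, which
  -- keeps its value `m`; this value is the height.
  #newCorners132-top : toℕ v ≡ suc m → K132.#newCorners v π t ≡ ⟦ t ≤? m ⟧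
  #newCorners132-top v≡1+m = sum-single (K132.highCorner? (insert v π) t zero ∘ suc) (t ≤? m) k₀
    (λ k (_ , _ , _ , u) → top-unique
      (ℕₚ.≤-trans (ℕₚ.≤-reflexive (sym π[k₀]≡m)) (to (insert-≤⇔ v π k₀ k) (u (suc k₀) (s≤s z≤n)))))
    (mk⇔ (λ (t≤h , _) → ℕₚ.≤-trans t≤h (s≤s⁻¹ (subst (toℕ (lookup (insert v π) (suc k₀)) <ₙ_) v≡1+m h<v)))
         (λ t≤m → ℕₚ.≤-trans t≤m m≤h , s≤s z≤n , h<v , λ { (suc k) _ → from (insert-≤⇔ v π k k₀) (π≤π[k₀] k) }))
    where
    h<v : lookup (insert v π) (suc k₀) < v
    h<v = ℕₚ.≤∧≢⇒<
      (ℕₚ.≤-trans (toℕ≤pred[n] (lookup (insert v π) (suc k₀))) (ℕₚ.≤-reflexive (sym v≡1+m)))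
      (λ e → punchInᵢ≢i v _ (trans (sym (lookup-insert v π k₀)) (toℕ-injective e)))

    m≤h : m ≤ₙ toℕ (lookup (insert v π) (suc k₀))
    m≤h = from (height⇔ v π k₀ m) (ℕₚ.≤-reflexive
      (trans (lower-≤ (subst (m ≤ₙ_) (sym v≡1+m) (ℕₚ.n≤1+n m))) (sym π[k₀]≡m)))

  -- The old maximum is pushed above `v`, yet a corner would force it to be at most the base, which
  -- lies below `v`.
  #newCorners132-other : toℕ v ≤ₙ m → K132.#newCorners v π t ≡ 0
  #newCorners132-other v≤m = sum-zero λ k → ⟦⟧-false (K132.highCorner? (insert v π) t zero (suc k))
    λ (_ , _ , p , u) → ℕₚ.<⇒≱
      (from (head-<⇔ v π k₀) (subst (toℕ v ≤ₙ_) (sym π[k₀]≡m) v≤m))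
      (ℕₚ.≤-trans (u (suc k₀) (s≤s z≤n)) (ℕₚ.<⇒≤ p))

-- Below the two largest values the insertions agree and create no corner. Inserting `m` for 123
-- matches inserting `suc m` for 132, each creating a corner of height `m`; in the reverse case
-- neither side gains one.
exchange-#corners-∷ : ∀ {m} (v : Fin (suc (suc m))) (c : Code (suc m)) →
  (∀ t → K123.#corners (decode c) t ≡ K132.#corners (decode (exchange c)) t) →
  ∀ t → K123.#corners (decode (v ∷ c)) t ≡ K132.#corners (decode (exchange (v ∷ c))) t
exchange-#corners-∷ {m} v c ih t =
  trans (K123.#corners-insert v (decode c) t)
    (trans (step (swapTopView v)) (sym (K132.#corners-insert (swapTop v) (decode (exchange c)) t)))
  where
  unaffected : ∀ {w} → m ≤ₙ toℕ v → m ≤ₙ w →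
    K123.#corners (decode c) (lower (toℕ v) t) ≡ K132.#corners (decode (exchange c)) (lower w t)
  unaffected m≤v m≤w = trans (K123.#corners-lower (decode c) m≤v t)
    (trans (ih t) (sym (K132.#corners-lower (decode (exchange c)) m≤w t)))

  step : SwapTopView v →
    K123.#newCorners v (decode c) t +ₙ K123.#corners (decode c) (lower (toℕ v) t) ≡
    K132.#newCorners (swapTop v) (decode (exchange c)) t +ₙ K132.#corners (decode (exchange c)) (lower (toℕ (swapTop v)) t)
  step (below v<m e) rewrite e = cong₂ _+ₙ_
    (trans (#newCorners123-other c v t (ℕₚ.<⇒≢ v<m)) (sym (#newCorners132-other (exchange c) v t (ℕₚ.<⇒≤ v<m))))
    (ih (lower (toℕ v) t))
  step (second v≡m w≡1+m) = cong₂ _+ₙ_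
    (trans (#newCorners123-second c v t v≡m) (sym (#newCorners132-top (exchange c) (swapTop v) t w≡1+m)))
    (unaffected (ℕₚ.≤-reflexive (sym v≡m)) (ℕₚ.≤-trans (ℕₚ.n≤1+n m) (ℕₚ.≤-reflexive (sym w≡1+m))))
  step (top v≡1+m w≡m) = cong₂ _+ₙ_
    (trans (#newCorners123-other c v t (λ v≡m → ℕₚ.1+n≢n (trans (sym v≡1+m) v≡m)))
           (sym (#newCorners132-other (exchange c) (swapTop v) t (ℕₚ.≤-reflexive w≡m))))
    (unaffected (ℕₚ.≤-trans (ℕₚ.n≤1+n m) (ℕₚ.≤-reflexive (sym v≡1+m))) (ℕₚ.≤-reflexive (sym w≡m)))

exchange-#corners : ∀ {n} (c : Code n) t → K123.#corners (decode c) t ≡ K132.#corners (decode (exchange c)) t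
exchange-#corners []              t = refl
-- With one entry nothing can be exchanged, and both recurrences reduce to empty sums.
exchange-#corners (zero ∷ [])     t = trans (K123.#corners-insert zero [] t) (sym (K132.#corners-insert zero [] t))
exchange-#corners (v ∷ c@(_ ∷ _)) t = exchange-#corners-∷ v c (exchange-#corners c) t

-- Each insertion adds the number of corners at or above the inserted value: equal numbers at a
-- common threshold, and zero on both sides for the two largest values.
exchange-#triples : ∀ {n} (c : Code n) → K123.#triples (decode c) ≡ K132.#triples (decode (exchange c))
exchange-#triples []      = refl
exchange-#triples (v ∷ c) =
  trans (K123.#triples-insert v (decode c))
    (trans (cong₂ _+ₙ_ (step v c) (exchange-#triples c))
      (sym (K132.#triples-insert (swapTop v) (decode (exchange c)))))
  where
  step : ∀ {n} (v : Fin (suc n)) (c : Code n) →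
         K123.#corners (decode c) (toℕ v) ≡ K132.#corners (decode (exchange c)) (toℕ (swapTop v))
  step zero [] = refl
  step {suc m} v c with swapTopView v
  ... | below _ e rewrite e = exchange-#corners c (toℕ v)
  ... | second v≡m w≡1+m = trans (K123.#corners-above (decode c) (ℕₚ.≤-reflexive (sym v≡m)))
    (sym (K132.#corners-above (decode (exchange c)) (ℕₚ.≤-trans (ℕₚ.n≤1+n m) (ℕₚ.≤-reflexive (sym w≡1+m)))))
  ... | top v≡1+m w≡m = trans (K123.#corners-above (decode c) (ℕₚ.≤-trans (ℕₚ.n≤1+n m) (ℕₚ.≤-reflexive (sym v≡1+m))))
    (sym (K132.#corners-above (decode (exchange c)) (ℕₚ.≤-reflexive (sym w≡m))))

-- Occurrences as triples

length-filter-map : ∀ {A B : Set} {P : Pred B 0ℓ} (P? : Decidable P) (f : A → B) xs →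
                    length (filter P? (List.map f xs)) ≡ length (filter (P? ∘ f) xs)
length-filter-map P? f []       = refl
length-filter-map P? f (x ∷ xs) with does (P? (f x))
... | true  = cong suc (length-filter-map P? f xs)
... | false = length-filter-map P? f xs

-- The reindexing `g` is for the induction, since the tail of `tabulate g` is a tabulation of
-- `g ∘ suc`; the case `g = id` gives `allFin`.
length-filter-concatMap : ∀ {A : Set} {P : Pred A 0ℓ} (P? : Decidable P) {m n} (f : Fin n → List A) (g : Fin m → Fin n) →
  length (filter P? (concatMap f (List.tabulate g))) ≡ ∑[ i < m ] length (filter P? (f (g i)))
length-filter-concatMap P? {zero}  f g = refl
length-filter-concatMap P? {suc m} f g = begin
  length (filter P? (f (g zero) List.++ rest))                    ≡⟨ cong length (filter-++ P? (f (g zero)) rest) ⟩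
  length (filter P? (f (g zero)) List.++ filter P? rest)          ≡⟨ length-++ (filter P? (f (g zero))) ⟩
  length (filter P? (f (g zero))) +ₙ length (filter P? rest)
    ≡⟨ cong (length (filter P? (f (g zero))) +ₙ_) (length-filter-concatMap P? f (g ∘ suc)) ⟩
  ∑[ i < suc m ] length (filter P? (f (g i)))                     ∎
  where
  open ≡-Reasoning
  rest = concatMap f (List.tabulate (g ∘ suc))

length-filter-allWords : ∀ {n k} {P : Pred (Vec (Fin n) (suc k)) 0ℓ} (P? : Decidable P) →
  length (filter P? (allWords n (suc k))) ≡ ∑[ x < n ] length (filter (P? ∘ (x ∷_)) (allWords n k))
length-filter-allWords {n} {k} P? =
  trans (length-filter-concatMap P? (λ x → List.map (x ∷_) (allWords n k)) id)
        (sum-cong-≗ λ x → length-filter-map P? (x ∷_) (allWords n k))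

length-filter-[_] : ∀ {A : Set} {P : Pred A 0ℓ} (P? : Decidable P) x → length (filter P? (x ∷ [])) ≡ ⟦ P? x ⟧
length-filter-[ P? ] x with does (P? x)
... | true  = refl
... | false = refl

occ-sum : ∀ {n} (p : MeshPattern 3) (π : Vec (Fin n) n) →
          occ p π ≡ ∑[ i < n ] count₂ (λ j k → occurrence? p π (i ∷ j ∷ k ∷ []))
occ-sum {n} p π = trans (length-filter-allWords P?) (sum-cong-≗ λ i →
  trans (length-filter-allWords {n} {1} (λ w → P? (i ∷ w))) (sum-cong-≗ λ j →
  trans (length-filter-allWords {n} {0} (λ w → P? (i ∷ j ∷ w))) (sum-cong-≗ λ k →
  length-filter-[ (λ (w : Vec (Fin n) 0) → P? (i ∷ j ∷ k ∷ w)) ] [])))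
  where P? = occurrence? p π

R : List (ℕ × ℕ)
R = (2 , 2) ∷ (2 , 3) ∷ (3 , 2) ∷ (3 , 3) ∷ []

p123 p132 : MeshPattern 3
p123 = mesh (1 ∷ 2 ∷ 3 ∷ []) R
p132 = mesh (1 ∷ 3 ∷ 2 ∷ []) R

-- Insertion sort treats the tail first; once its two comparisons are decided, it computes.
sort-123 : ∀ {x y z} → x <ₙ y → y <ₙ z → sort (x ∷ y ∷ z ∷ []) ≡ x ∷ y ∷ z ∷ []
sort-123 {x} {y} {z} x<y y<z
  rewrite dec-true (y ≤? z) (ℕₚ.<⇒≤ y<z) | dec-true (x ≤? y) (ℕₚ.<⇒≤ x<y) = refl

sort-132 : ∀ {x y z} → x <ₙ y → y <ₙ z → sort (x ∷ z ∷ y ∷ []) ≡ x ∷ y ∷ z ∷ []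
sort-132 {x} {y} {z} x<y y<z
  rewrite dec-false (z ≤? y) (ℕₚ.<⇒≱ y<z) | dec-true (x ≤? y) (ℕₚ.<⇒≤ x<y) = refl

-- Shared by both patterns: `j` and `k` are the columns of the last two letters, `a` and `b` the
-- values of the letters 2 and 3, in whichever order these stand.
module _ {n} (π : Vec (Fin n) n) (i {j k} : Fin n) {x a b} (j<k : j < k) (a<b : a <ₙ b)
         (sorted : sort (List.map (val π) (toList (i ∷ j ∷ k ∷ []))) ≡ x ∷ a ∷ b ∷ []) where
  private
    is : Vec (Fin n) 3
    is = i ∷ j ∷ k ∷ []

    v₂ : valBound π is 2 ≡ a
    v₂ = cong (λ l → nth l (suc n) 1) sorted

    v₃ : valBound π is 3 ≡ b
    v₃ = cong (λ l → nth l (suc n) 2) sorted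

    -- The index runs past the three sorted values, so `nth` returns its default, the upper border.
    v₄ : valBound π is 4 ≡ suc n
    v₄ = cong (λ l → nth l (suc n) 3) sorted

  -- The four boxes tile the quadrant right of `j` and above `a`, except for the column of `k` and
  -- the row of `b`.
  R-empty⇒ : (∀ {box} → box ∈ R → BoxEmpty π is box) →
             ∀ m → j < m → a <ₙ val π m → m ≡ k ⊎ val π m ≡ b
  R-empty⇒ empty m j<m a<m with <-cmp m k | ℕₚ.<-cmp (val π m) b
  ... | tri≈ _ m≡k _ | _            = inj₁ m≡k
  ... | _            | tri≈ _ e _   = inj₂ e
  ... | tri< m<k _ _ | tri< v<b _ _ = contradiction
    (s≤s j<m , s≤s m<k , subst (_<ₙ _) (sym v₂) a<m , subst (_ <ₙ_) (sym v₃) v<b)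
    (empty (here refl) m)
  ... | tri< m<k _ _ | tri> _ _ b<v = contradiction
    (s≤s j<m , s≤s m<k , subst (_<ₙ _) (sym v₃) b<v , subst (_ <ₙ_) (sym v₄) (s≤s (toℕ<n (lookup π m))))
    (empty (there (here refl)) m)
  ... | tri> _ _ k<m | tri< v<b _ _ = contradiction
    (s≤s k<m , s≤s (toℕ<n m) , subst (_<ₙ _) (sym v₂) a<m , subst (_ <ₙ_) (sym v₃) v<b)
    (empty (there (there (here refl))) m)
  ... | tri> _ _ k<m | tri> _ _ b<v = contradiction
    (s≤s k<m , s≤s (toℕ<n m) , subst (_<ₙ _) (sym v₃) b<v , subst (_ <ₙ_) (sym v₄) (s≤s (toℕ<n (lookup π m))))
    (empty (there (there (there (here refl)))) m)

  -- A box lies strictly off that column and that row. Boxes right of `k` are also right of `j`, and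
  -- boxes above `b` are also above `a`.
  ⇒R-empty : (∀ m → j < m → a <ₙ val π m → m ≡ k ⊎ val π m ≡ b) →
             ∀ {box} → box ∈ R → BoxEmpty π is box
  ⇒R-empty only (here refl) m (p , q , r , s)
    with only m (s≤s⁻¹ p) (subst (_<ₙ val π m) v₂ r)
  ... | inj₁ refl = ℕₚ.<-irrefl refl q
  ... | inj₂ e    = ℕₚ.<-irrefl e (subst (val π m <ₙ_) v₃ s)
  ⇒R-empty only (there (here refl)) m (p , q , r , s)
    with only m (s≤s⁻¹ p) (ℕₚ.<-trans a<b (subst (_<ₙ val π m) v₃ r))
  ... | inj₁ refl = ℕₚ.<-irrefl refl q
  ... | inj₂ e    = ℕₚ.<-irrefl (sym e) (subst (_<ₙ val π m) v₃ r)
  ⇒R-empty only (there (there (here refl))) m (p , q , r , s)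
    with only m (ℕₚ.<-trans j<k (s≤s⁻¹ p)) (subst (_<ₙ val π m) v₂ r)
  ... | inj₁ refl = ℕₚ.<-irrefl refl p
  ... | inj₂ e    = ℕₚ.<-irrefl e (subst (val π m <ₙ_) v₃ s)
  ⇒R-empty only (there (there (there (here refl)))) m (p , q , r , s)
    with only m (ℕₚ.<-trans j<k (s≤s⁻¹ p)) (ℕₚ.<-trans a<b (subst (_<ₙ val π m) v₃ r))
  ... | inj₁ refl = ℕₚ.<-irrefl refl p
  ... | inj₂ e    = ℕₚ.<-irrefl (sym e) (subst (_<ₙ val π m) v₃ r)

increasing₃ : ∀ {n} {i j k : Fin n} → i < j → j < k → Increasing (i ∷ j ∷ k ∷ [])
increasing₃ i<j j<k zero       (suc zero)       _ = i<j
increasing₃ i<j j<k zero       (suc (suc zero)) _ = ℕₚ.<-trans i<j j<k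
increasing₃ i<j j<k (suc zero) (suc (suc zero)) _ = j<k
increasing₃ i<j j<k (suc zero)       (suc zero)       (s≤s ())
increasing₃ i<j j<k (suc (suc zero)) (suc zero)       (s≤s ())
increasing₃ i<j j<k (suc (suc zero)) (suc (suc zero)) (s≤s (s≤s ()))

-- As the letters of `τ` are distinct, trichotomy yields the converse of `mono`.
orderIso : ∀ {n k} (π : Vec (Fin n) n) (τ : Vec ℕ k) (is : Vec (Fin n) k) →
           (∀ a b → lookup τ a ≡ lookup τ b → a ≡ b) →
           (∀ a b → lookup τ a <ₙ lookup τ b → val π (lookup is a) <ₙ val π (lookup is b)) →
           OrderIso π τ is
orderIso π τ is τ-inj mono a b = reflect , mono a b
  where
  reflect : _ → lookup τ a <ₙ lookup τ b
  reflect p with ℕₚ.<-cmp (lookup τ a) (lookup τ b)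
  ... | tri< τa<τb _ _ = τa<τb
  ... | tri≈ _ τa≡τb _ with refl ← τ-inj a b τa≡τb = contradiction p (ℕₚ.<-irrefl refl)
  ... | tri> _ _ τb<τa = contradiction p (ℕₚ.<-asym (mono b a τb<τa))

occurrence123⇔ : ∀ {n} {π : Vec (Fin n) n} → IsPerm π → ∀ i j k →
                 Occurrence p123 π (i ∷ j ∷ k ∷ []) ⇔ K123.Triple π i j k
occurrence123⇔ {n} {π} inj i j k = mk⇔ ⇒ ⇐
  where
  ⇒ : Occurrence p123 π (i ∷ j ∷ k ∷ []) → K123.Triple π i j k
  ⇒ (inc , iso , empty) = inc zero (suc zero) (s≤s z≤n) , s≤s⁻¹ x<y , j<k , s≤s⁻¹ y<z , only
    where
    j<k = inc (suc zero) (suc (suc zero)) (s≤s (s≤s z≤n))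
    x<y = proj₂ (iso zero (suc zero)) (s≤s (s≤s z≤n))
    y<z = proj₂ (iso (suc zero) (suc (suc zero))) (s≤s (s≤s (s≤s z≤n)))
    only : ∀ m → j < m → lookup π j < lookup π m → m ≡ k
    only m j<m p with R-empty⇒ π i j<k y<z (sort-123 x<y y<z) empty m j<m (s≤s p)
    ... | inj₁ m≡k = m≡k
    -- Here `b` is the value at `k`, so an entry in its row stands at `k`.
    ... | inj₂ e   = inj m k (toℕ-injective (ℕₚ.suc-injective e))

  ⇐ : K123.Triple π i j k → Occurrence p123 π (i ∷ j ∷ k ∷ [])
  ⇐ (i<j , x<y , j<k , y<z , only) =
    increasing₃ i<j j<k ,
    orderIso π τ is (toWitness {a? = all? λ a → all? λ b → (lookup τ a ≟ₙ lookup τ b) →-dec (a ≟ b)} _) mono ,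
    ⇒R-empty π i j<k (s≤s y<z) (sort-123 (s≤s x<y) (s≤s y<z)) (λ m j<m p → inj₁ (only m j<m (s≤s⁻¹ p)))
    where
    τ : Vec ℕ 3
    τ = 1 ∷ 2 ∷ 3 ∷ []
    is : Vec (Fin n) 3
    is = i ∷ j ∷ k ∷ []
    mono : ∀ a b → lookup τ a <ₙ lookup τ b → val π (lookup is a) <ₙ val π (lookup is b)
    mono zero             zero             (s≤s ())
    mono zero             (suc zero)       _ = s≤s x<y
    mono zero             (suc (suc zero)) _ = s≤s (ℕₚ.<-trans x<y y<z)
    mono (suc zero)       zero             (s≤s ())
    mono (suc zero)       (suc zero)       (s≤s (s≤s ()))
    mono (suc zero)       (suc (suc zero)) _ = s≤s y<z
    mono (suc (suc zero)) zero             (s≤s ())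
    mono (suc (suc zero)) (suc zero)       (s≤s (s≤s ()))
    mono (suc (suc zero)) (suc (suc zero)) (s≤s (s≤s (s≤s ())))

occurrence132⇔ : ∀ {n} {π : Vec (Fin n) n} → IsPerm π → ∀ i j k →
                 Occurrence p132 π (i ∷ j ∷ k ∷ []) ⇔ K132.Triple π i j k
occurrence132⇔ {n} {π} inj i j k = mk⇔ ⇒ ⇐
  where
  ⇒ : Occurrence p132 π (i ∷ j ∷ k ∷ []) → K132.Triple π i j k
  ⇒ (inc , iso , empty) = inc zero (suc zero) (s≤s z≤n) , s≤s⁻¹ x<y , j<k , s≤s⁻¹ y<z , λ m j<m → ℕₚ.≮⇒≥ (none m j<m)
    where
    j<k = inc (suc zero) (suc (suc zero)) (s≤s (s≤s z≤n))
    x<y = proj₂ (iso zero (suc (suc zero))) (s≤s (s≤s z≤n))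
    y<z = proj₂ (iso (suc (suc zero)) (suc zero)) (s≤s (s≤s (s≤s z≤n)))
    none : ∀ m → j < m → ¬ (lookup π k < lookup π m)
    none m j<m p with R-empty⇒ π i j<k y<z (sort-132 x<y y<z) empty m j<m (s≤s p)
    -- Now the letter 3 stands at `j` and the letter 2 at `k`: the entry in column `k` is not above
    -- itself, and the entry in row `b` is at `j`, not to its right. The quadrant is therefore
    -- empty.
    ... | inj₁ refl = ℕₚ.<-irrefl refl p
    ... | inj₂ e with refl ← inj m j (toℕ-injective (ℕₚ.suc-injective e)) = ℕₚ.<-irrefl refl j<m

  ⇐ : K132.Triple π i j k → Occurrence p132 π (i ∷ j ∷ k ∷ [])
  ⇐ (i<j , x<y , j<k , y<z , low) =
    increasing₃ i<j j<k ,
    orderIso π τ is (toWitness {a? = all? λ a → all? λ b → (lookup τ a ≟ₙ lookup τ b) →-dec (a ≟ b)} _) mono ,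
    ⇒R-empty π i j<k (s≤s y<z) (sort-132 (s≤s x<y) (s≤s y<z)) (λ m j<m p → contradiction (s≤s⁻¹ p) (ℕₚ.≤⇒≯ (low m j<m)))
    where
    τ : Vec ℕ 3
    τ = 1 ∷ 3 ∷ 2 ∷ []
    is : Vec (Fin n) 3
    is = i ∷ j ∷ k ∷ []
    mono : ∀ a b → lookup τ a <ₙ lookup τ b → val π (lookup is a) <ₙ val π (lookup is b)
    mono zero             zero             (s≤s ())
    mono zero             (suc zero)       _ = s≤s (ℕₚ.<-trans x<y y<z)
    mono zero             (suc (suc zero)) _ = s≤s x<y
    mono (suc zero)       zero             (s≤s ())
    mono (suc zero)       (suc zero)       (s≤s (s≤s (s≤s ())))
    mono (suc zero)       (suc (suc zero)) (s≤s (s≤s ()))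
    mono (suc (suc zero)) zero             (s≤s ())
    mono (suc (suc zero)) (suc zero)       _ = s≤s y<z
    mono (suc (suc zero)) (suc (suc zero)) (s≤s (s≤s ()))

occ123≡#triples : ∀ {n} {π : Vec (Fin n) n} → IsPerm π → occ p123 π ≡ K123.#triples π
occ123≡#triples {π = π} inj = trans (occ-sum p123 π)
  (sum-cong-≗ λ i → count₂-cong (λ j k → occurrence? p123 π (i ∷ j ∷ k ∷ [])) (K123.triple? π i) (occurrence123⇔ inj i))

occ132≡#triples : ∀ {n} {π : Vec (Fin n) n} → IsPerm π → occ p132 π ≡ K132.#triples π
occ132≡#triples {π = π} inj = trans (occ-sum p132 π)
  (sum-cong-≗ λ i → count₂-cong (λ j k → occurrence? p132 π (i ∷ j ∷ k ∷ [])) (K132.triple? π i) (occurrence132⇔ inj i))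

occ-exchange : ∀ {n} (c : Code n) → occ p123 (decode c) ≡ occ p132 (decode (exchange c))
occ-exchange c = trans (occ123≡#triples (decode-isPerm c))
  (trans (exchange-#triples c) (sym (occ132≡#triples (decode-isPerm (exchange c)))))

-- Enumeration of permutations by codes

codes : ∀ n → List (Code n)
codes zero    = [] ∷ []
codes (suc n) = cartesianProductWith _∷_ (allFin (suc n)) (codes n)

codes-unique : ∀ n → Unique (codes n)
codes-unique zero    = [] ∷ []
codes-unique (suc n) = Unique.cartesianProductWith⁺ _∷_ (λ { refl → refl , refl }) (Unique.allFin⁺ (suc n)) (codes-unique n)

∈-codes : ∀ {n} (c : Code n) → c ∈ codes n
∈-codes []      = here refl
∈-codes (v ∷ c) = ∈-cartesianProductWith⁺ _∷_ (∈-allFin v) (∈-codes c)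

-- Lets `allWords` inherit uniqueness and membership from cartesian products.
concatMap-map≡cartesianProductWith : ∀ {A B C : Set} (f : A → B → C) xs ys →
  concatMap (λ x → List.map (f x) ys) xs ≡ cartesianProductWith f xs ys
concatMap-map≡cartesianProductWith f []       ys = refl
concatMap-map≡cartesianProductWith f (x ∷ xs) ys =
  cong (List.map (f x) ys List.++_) (concatMap-map≡cartesianProductWith f xs ys)

allWords-unique : ∀ n k → Unique (allWords n k)
allWords-unique n zero    = [] ∷ []
allWords-unique n (suc k) = subst Unique (sym (concatMap-map≡cartesianProductWith _∷_ (allFin n) (allWords n k)))
  (Unique.cartesianProductWith⁺ _∷_ ∷-injective (Unique.allFin⁺ n) (allWords-unique n k))

∈-allWords : ∀ {n k} (w : Vec (Fin n) k) → w ∈ allWords n k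
∈-allWords         []                  = here refl
∈-allWords {n} {suc k} (x ∷ w) =
  subst (x ∷ w ∈_) (sym (concatMap-map≡cartesianProductWith _∷_ (allFin n) (allWords n k)))
    (∈-cartesianProductWith⁺ _∷_ (∈-allFin x) (∈-allWords w))

-- Both lists are free of repetitions and have the same elements: `decode ∘ f` is injective, and it
-- reaches `decode c` from `f c`.
S↭decode : ∀ {n} (f : Code n → Code n) → (∀ c → f (f c) ≡ c) → S n ↭ List.map (decode ∘ f) (codes n)
S↭decode {n} f f-involutive = ∼bag⇒↭ (unique∧set⇒bag
  (Unique.filter⁺ isPerm? (allWords-unique n n))
  (Unique.map⁺ (λ {c} {d} e → trans (sym (f-involutive c)) (trans (cong f (decode-injective e)) (f-involutive d)))
               (codes-unique n))
  (mk⇔ ⇒ ⇐))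
  where
  ⇒ : ∀ {π} → π ∈ S n → π ∈ List.map (decode ∘ f) (codes n)
  ⇒ {π} π∈S with c , refl ← isPerm⇒decode π (proj₂ (∈-filter⁻ isPerm? {xs = allWords n n} π∈S)) =
    subst (λ d → decode d ∈ _) (f-involutive c) (∈-map⁺ (decode ∘ f) (∈-codes (f c)))

  ⇐ : ∀ {π} → π ∈ List.map (decode ∘ f) (codes n) → π ∈ S n
  ⇐ π∈ with c , _ , refl ← ∈-map⁻ (decode ∘ f) π∈ = ∈-filter⁺ isPerm? (∈-allWords _) (decode-isPerm (f c))

-- Enumerating the permutations once by `decode` and once by `decode ∘ exchange` aligns the two
-- statistics code by code.
occ-↭ : ∀ n → List.map (occ p123) (S n) ↭ List.map (occ p132) (S n)
occ-↭ n = ↭-trans (map⁺ (occ p123) (S↭decode id λ _ → refl))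
  (↭-trans (↭-reflexive (begin
    List.map (occ p123) (List.map decode (codes n))              ≡⟨ map-∘ (codes n) ⟨
    List.map (occ p123 ∘ decode) (codes n)                       ≡⟨ map-cong occ-exchange (codes n) ⟩
    List.map (occ p132 ∘ decode ∘ exchange) (codes n)            ≡⟨ map-∘ (codes n) ⟩
    List.map (occ p132) (List.map (decode ∘ exchange) (codes n)) ∎))
  (↭-sym (map⁺ (occ p132) (S↭decode exchange exchange-involutive))))
  where open ≡-Reasoning

theorem4p4 : Equidistributed
    (mesh (1 ∷ 2 ∷ 3 ∷ []) ((2 , 2) ∷ (2 , 3) ∷ (3 , 2) ∷ (3 , 3) ∷ []))
    (mesh (1 ∷ 3 ∷ 2 ∷ []) ((2 , 2) ∷ (2 , 3) ∷ (3 , 2) ∷ (3 , 3) ∷ []))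
theorem4p4 n ℓ = begin
  -- The count is the multiplicity of `ℓ` in the list of occurrence numbers, which does not depend
  -- on the order of that list.
  length (filter (λ π → occ p123 π ≟ₙ ℓ) (S n))            ≡⟨ length-filter-map (_≟ₙ ℓ) (occ p123) (S n) ⟨
  length (filter (_≟ₙ ℓ) (List.map (occ p123) (S n)))      ≡⟨ ↭-length (filter-↭ (_≟ₙ ℓ) (occ-↭ n)) ⟩
  length (filter (_≟ₙ ℓ) (List.map (occ p132) (S n)))      ≡⟨ length-filter-map (_≟ₙ ℓ) (occ p132) (S n) ⟩
  length (filter (λ π → occ p132 π ≟ₙ ℓ) (S n))            ∎
  where open ≡-Reasoning
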